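{- For every integer $c\ge 7$ we have $\delta_1(c)\le \frac{c^2+6c-5}{4}$.
   Context: An embedded graph is a connected graph together with a combinatorial embedding in an orientable surface: every edge $\{v,w\}$ is regarded as two directed edges $(v,w)$ and $(w,v)$, and for every vertex $v$ the directed edges $(v,\cdot)$ are given a cyclic (rotational) order. A face is a cyclic sequence $(v_0,v_1),(v_1,v_2),\dots,(v_{k-1},v_0)$ of pairwise different directed edges such that for each $i$ the edge $(v_{i+1},v_{i+2})$ follows $(v_{i+1},v_i)$ in the cyclic order around $v_{i+1}$ (indices mod $k$); $k$ is the size of the face. The genus $g$ of an embedded graph with $v$ vertices, $e$ edges and $f$ faces is defined by $v-e+f=2-2g$. The dual $G^*$ of an embedded graph $G$ has the faces of $G$ as vertices and, for every edge of $G$, an edge joining the two faces containing its two directed edges. A $k$-cut of a graph is a set of $k$ vertices whose removal disconnects the graph. For $c\ge k\ge 1$, $\delta_k(c)$ is the minimum $s$ such that there exists a simple $c$-connected embedded graph $G$ of genus $s$ whose dual $G^*$ is a simple graph with a $k$-cut. -}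

module Defs where

open import Data.Nat using (ℕ; zero; suc; _+_; _*_; _∸_; _≤_; _<_; _<ᵇ_)
open import Data.Bool using (Bool; true; false; _∧_; if_then_else_)
open import Data.Fin using (Fin; toℕ)
open import Data.Fin.Subset using (Subset; _∉_; ∣_∣)
open import Data.List using (List; map; allFin)
open import Data.Nat.ListAction using (sum)
open import Data.Product using (Σ; ∃; ∃-syntax; _×_; _,_; proj₁; proj₂)
open import Data.Sum using (_⊎_)
open import Data.Unit using (⊤)
open import Relation.Nullary using (¬_)
open import Relation.Binary.PropositionalEquality using (_≡_)

iter : {A : Set} → (A → A) → ℕ → A → A
iter f zero    x = x
iter f (suc k) x = f (iter f k x)

data Walk {n : ℕ} (E : Fin n → Fin n → Bool) (Allowed : Fin n → Set)
          : Fin n → Fin n → Set where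
  here : ∀ {u} → Walk E Allowed u u
  step : ∀ {u v w} → Walk E Allowed u v → E v w ≡ true → Allowed w →
         Walk E Allowed u w

-- An embedded (simple) graph on vertex set Fin n.
-- Directed edges are the pairs (v , w) with E v w ≡ true.
-- rot v w is the directed edge (v , rot v w) following (v , w) in the
-- cyclic order around v (only meaningful when w is a neighbour of v);
-- rot-closed and rot-cyclic say that rot v is a cyclic permutation of the
-- neighbours of v (a function under which all neighbours are mutually
-- reachable is a single cycle).
record EmbeddedGraph : Set where
  field
    n          : ℕ
    E          : Fin n → Fin n → Bool
    E-sym      : ∀ v w → E v w ≡ E w v
    E-irrefl   : ∀ v → E v v ≡ false
    rot        : Fin n → Fin n → Fin n
    rot-closed : ∀ v w → E v w ≡ true → E v (rot v w) ≡ true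
    rot-cyclic : ∀ v w w' → E v w ≡ true → E v w' ≡ true →
                 ∃[ k ] iter (rot v) k w ≡ w'
    connected  : ∀ u w → Walk E (λ _ → ⊤) u w

module _ (G : EmbeddedGraph) where
  open EmbeddedGraph G

  Dart : Set
  Dart = Fin n × Fin n

  IsDart : Dart → Set
  IsDart (v , w) = E v w ≡ true

  rev : Dart → Dart
  rev (v , w) = (w , v)

  faceNext : Dart → Dart
  faceNext (v , w) = (w , rot w v)

  SameFace : Dart → Dart → Set
  SameFace d d' = ∃[ k ] iter faceNext k d ≡ d'

  edgeCount : ℕ
  edgeCount = sum (map (λ v → sum (map (λ w →
                if E v w ∧ (toℕ v <ᵇ toℕ w) then 1 else 0)
                (allFin n))) (allFin n))

  FaceCount : ℕ → Set
  FaceCount f = Σ (Fin f → Dart) λ rep →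
      (∀ i → IsDart (rep i)) ×
      (∀ d → IsDart d → Σ (Fin f) λ i →
          SameFace (rep i) d × (∀ j → SameFace (rep j) d → j ≡ i))

  -- genus g :  v - e + f = 2 - 2g
  HasGenus : ℕ → Set
  HasGenus g = Σ ℕ λ f → FaceCount f × (n + f + 2 * g ≡ 2 + edgeCount)

  Connectedness : ℕ → Set
  Connectedness c = (c < n) × ((S : Subset n) → ∣ S ∣ < c →
      ∀ u w → u ∉ S → w ∉ S → Walk E (λ x → x ∉ S) u w)

  DualSimple : Set
  DualSimple =
    (∀ d → IsDart d → ¬ SameFace d (rev d)) ×
    (∀ d d' → IsDart d → IsDart d' → SameFace d d' → SameFace (rev d) (rev d') →
       (d ≡ d') ⊎ (d ≡ rev d'))

  -- Walks in G* − F, where F is the face of d₀, expressed on directed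
  -- edges: one may move within a face, or cross an edge to the other face.
  data DualWalk (d₀ : Dart) : Dart → Dart → Set where
    here  : ∀ {x} → DualWalk d₀ x x
    along : ∀ {x y z} → DualWalk d₀ x y → SameFace y z → IsDart z →
            ¬ SameFace d₀ z → DualWalk d₀ x z
    cross : ∀ {x y} → DualWalk d₀ x y → ¬ SameFace d₀ (rev y) →
            DualWalk d₀ x (rev y)

  DualHas1Cut : Set
  DualHas1Cut = Σ Dart λ d₀ → IsDart d₀ × Σ Dart λ x → Σ Dart λ y →
      IsDart x × IsDart y × ¬ SameFace d₀ x × ¬ SameFace d₀ y ×
      ¬ DualWalk d₀ x y

Realizes-δ₁ : ℕ → ℕ → Set
Realizes-δ₁ c s = Σ EmbeddedGraph λ G →
  Connectedness G c × HasGenus G s × DualSimple G × DualHas1Cut G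

{-# OPTIONS --safe #-}
module Submission where

-- Start from Ringel's quadrangular embedding of K_{2P,2Q}: with the vertices
-- of each class in a cyclic order, the faces are the quadrangles spanned by two
-- consecutive vertices of either class, of two kinds X and Y, each edge lying
-- on one X and one Y. Embed K₆ on the torus with a hexagonal face through all six
-- vertices and eight triangles. Identify its vertices with six vertices of one
-- class, inserting the rotation of K₆ (cut at the hexagon) at each of them into
-- the corner of an X quadrangle. The hexagon and the six quadrangles then form
-- one face F, and F separates the triangles from the other quadrangles in the
-- dual. The dual stays simple because no Y meets two of the six quadrangles.
-- The genus is (P − 1)(Q − 1) + 6 and the graph is min(2P, 2Q)-connected.

open import Defs
open import Data.Bool using (Bool; true; false; not; _∧_; _xor_; if_then_else_)
import Data.Bool.Properties as Bool
open import Data.Bool.Properties using (not-involutive)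
open import Data.Empty using (⊥-elim)
open import Data.Fin using (Fin; zero; suc; fromℕ; inject₁; remQuot; toℕ; _↑ˡ_; _↑ʳ_)
open import Data.Fin.Induction using (<-weakInduction; >-weakInduction)
open import Data.Fin.Patterns using (0F; 1F; 2F)
import Data.Fin.Properties as Fin
open import Data.Fin.Relation.Unary.Top using (view; ‵fromℕ; ‵inject₁; view-fromℕ; view-inject₁)
open import Data.Fin.Subset using (Subset; inside; outside; _∉_; ∣_∣)
open import Data.List using (allFin; map; tabulate)
open import Data.List.Properties using (map-tabulate; tabulate-cong)
open import Data.Maybe using (Maybe; just; nothing; is-just; maybe′)
open import Data.Nat using (ℕ; zero; suc; _+_; _*_; _∸_; _≤_; _<_; _<ᵇ_; z≤n; s≤s)
open import Data.Nat.ListAction using (sum)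
open import Data.Nat.Properties
open import Data.Nat.Tactic.RingSolver using (solve-∀)
open import Data.Product using (Σ; ∃-syntax; _×_; _,_; proj₁; proj₂; swap; uncurry)
open import Data.Product.Function.NonDependent.Propositional using (_×-↔_)
open import Data.Sum using (_⊎_; inj₁; inj₂)
open import Data.Sum.Function.Propositional using (_⊎-↔_)
open import Data.Sum.Properties using (≡-dec)
open import Data.Unit using (⊤; tt)
open import Data.Vec using (_∷_; there)
open import Function using (_∘_; id)
open import Function.Bundles using (_↔_; mk↔ₛ′; module Equivalence; module Inverse)
open import Function.Properties.Inverse using (↔-refl; ↔-trans)
open import Relation.Binary.Definitions using (DecidableEquality)
open import Relation.Binary.PropositionalEquality using (_≡_; _≢_; refl; sym; trans; cong; cong₂; subst; module ≡-Reasoning)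
open import Relation.Nullary using (¬_; does)
open import Relation.Nullary.Decidable using (dec-true; dec-false)

-- Reachability under iteration

Reach : {A : Set} → (A → A) → A → A → Set
Reach f x y = ∃[ k ] iter f k x ≡ y

module _ {A : Set} {f : A → A} where

  stay : ∀ {x} → Reach f x x
  stay = 0 , refl

  once : ∀ {x y} → f x ≡ y → Reach f x y
  once eq = 1 , eq

  infixl 5 _▷_ _▷▷_

  _▷_ : ∀ {x y z} → Reach f x y → f y ≡ z → Reach f x z
  (k , p) ▷ q = suc k , trans (cong f p) q

  _▷▷_ : ∀ {x y z} → Reach f x y → Reach f y z → Reach f x z
  p ▷▷ (zero  , refl) = p
  p ▷▷ (suc k , refl) = p ▷▷ (k , refl) ▷ refl

  Reach-invariant : (P : A → Set) → (∀ x → P x → P (f x)) →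
                    ∀ {x y} → P x → Reach f x y → P y
  Reach-invariant P pres p (zero  , refl) = p
  Reach-invariant P pres p (suc k , refl) = pres _ (Reach-invariant P pres p (k , refl))

Reach-lift : {A B : Set} {f : A → A} {g : B → B} (h : A → B) →
             (∀ x → Reach g (h x) (h (f x))) →
             ∀ {x y} → Reach f x y → Reach g (h x) (h y)
Reach-lift h lift (zero  , refl) = stay
Reach-lift h lift (suc k , refl) = Reach-lift h lift (k , refl) ▷▷ lift _

-- Cyclic orders with marked elements

record MarkedCycle (S T : Set) : Set where
  field
    next prev  : S ⊎ T → S ⊎ T
    next-prev  : ∀ r → next (prev r) ≡ r
    prev-next  : ∀ r → prev (next r) ≡ r
    next-reach : ∀ r r′ → Reach next r r′
    prev-reach : ∀ r r′ → Reach prev r r′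
    prev≢      : ∀ r → prev r ≢ r
    -- No two marked elements are consecutive. This is what keeps a `Y` quadrangle from meeting two
    -- of the six glued quadrangles.
    prev-mark  : ∀ k → ∃[ j ] prev (inj₁ k) ≡ inj₂ j

  shift : Bool → S ⊎ T → S ⊎ T
  shift true  = next
  shift false = prev

  shift-reach : ∀ x r r′ → Reach (shift x) r r′
  shift-reach true  = next-reach
  shift-reach false = prev-reach

  -- gap true r and gap false r number the gaps after and before r, a gap bearing the
  -- number of the element it follows.
  gap : Bool → S ⊎ T → S ⊎ T
  gap true  r = r
  gap false r = prev r

  -- A gap has at most one marked end, since marks are not consecutive, and this picks it out. For a
  -- gap with no marked end the value is arbitrary.
  nearMark : S ⊎ T → S ⊎ T
  nearMark (inj₁ k) = inj₁ k
  nearMark (inj₂ j) = next (inj₂ j)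

  nearMark-gap : ∀ x k → nearMark (gap x (inj₁ k)) ≡ inj₁ k
  nearMark-gap true  k = refl
  nearMark-gap false k with prev (inj₁ k) | prev-mark k | next-prev (inj₁ k)
  ... | _ | j , refl | eq = eq

  module _ (_≟_ : DecidableEquality (S ⊎ T)) where

    gap-side : ∀ x r → does (gap x r ≟ r) ≡ x
    gap-side true  r = dec-true  (r ≟ r) refl
    gap-side false r = dec-false (prev r ≟ r) (prev≢ r)

-- The standard cycle on `Fin` and its two markings

next° prev° : ∀ {n} → Fin (suc n) → Fin (suc n)
next° i with view i
... | ‵fromℕ     = zero
... | ‵inject₁ j = suc j
prev° zero    = fromℕ _
prev° (suc i) = inject₁ i

next°-fromℕ : ∀ n → next° (fromℕ n) ≡ zero
next°-fromℕ n rewrite view-fromℕ n = refl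

next°-inject₁ : ∀ {n} (i : Fin n) → next° (inject₁ i) ≡ suc i
next°-inject₁ i rewrite view-inject₁ i = refl

next°-prev° : ∀ {n} (i : Fin (suc n)) → next° (prev° i) ≡ i
next°-prev° zero    = next°-fromℕ _
next°-prev° (suc i) = next°-inject₁ i

prev°-next° : ∀ {n} (i : Fin (suc n)) → prev° (next° i) ≡ i
prev°-next° i with view i
... | ‵fromℕ     = refl
... | ‵inject₁ j = refl

next°-reach : ∀ {n} (i j : Fin (suc n)) → Reach next° i j
next°-reach {n} i j = to-zero i ▷▷ from-zero j
  where
  to-zero : ∀ i → Reach next° i zero
  to-zero = >-weakInduction (λ i → Reach next° i zero) (once (next°-fromℕ n))
    (λ i p → once (next°-inject₁ i) ▷▷ p)
  from-zero : ∀ i → Reach next° zero i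
  from-zero = <-weakInduction (Reach next° zero) stay
    (λ i p → p ▷ next°-inject₁ i)

prev°-reach : ∀ {n} (i j : Fin (suc n)) → Reach prev° i j
prev°-reach {n} i j = to-zero i ▷▷ from-zero j
  where
  to-zero : ∀ i → Reach (prev° {n}) i zero
  to-zero = <-weakInduction (λ i → Reach prev° i zero) stay
    (λ i p → once refl ▷▷ p)
  from-zero : ∀ i → Reach prev° zero i
  from-zero = >-weakInduction (Reach prev° zero) (once refl)
    (λ i p → p ▷ refl)

prev°≢ : ∀ {n} (i : Fin (suc (suc n))) → prev° i ≢ i
prev°≢ zero    ()
prev°≢ (suc i) eq with cong toℕ eq
... | eq′ rewrite Fin.toℕ-inject₁ i = 1+n≢n (sym eq′)

module _ {S T : Set} {n : ℕ} (e : (S ⊎ T) ↔ Fin (suc (suc n))) where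
  open Inverse e

  markedCycle : (∀ k → ∃[ j ] from (prev° (to (inj₁ k))) ≡ inj₂ j) → MarkedCycle S T
  markedCycle marks = record
    { next       = from ∘ next° ∘ to
    ; prev       = from ∘ prev° ∘ to
    ; next-prev  = λ r → trans (cong (from ∘ next°) (strictlyInverseˡ _))
                         (trans (cong from (next°-prev° (to r))) (strictlyInverseʳ r))
    ; prev-next  = λ r → trans (cong (from ∘ prev°) (strictlyInverseˡ _))
                         (trans (cong from (prev°-next° (to r))) (strictlyInverseʳ r))
    ; next-reach = transport (next°-reach {suc n})
    ; prev-reach = transport (prev°-reach {suc n})
    ; prev≢      = λ r eq → prev°≢ (to r) (trans (sym (strictlyInverseˡ _)) (cong to eq))
    ; prev-mark  = marks
    }
    where
    transport : ∀ {f : Fin (suc (suc n)) → Fin (suc (suc n))} → (∀ i j → Reach f i j) →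
                ∀ r r′ → Reach (from ∘ f ∘ to) r r′
    transport {f} reach r r′ =
      subst (Reach _ r) (strictlyInverseʳ r′)
        (subst (λ z → Reach _ z (from (to r′))) (strictlyInverseʳ r)
          (Reach-lift from (λ i → once (cong (from ∘ f) (strictlyInverseˡ i))) (reach (to r) (to r′))))

-- The marks sit at positions 0, 2 and 4. Position 5 always exists, so 4 and 0 are not consecutive
-- around the wrap.
rowPositions : ∀ m → (Fin 3 ⊎ Fin (3 + m)) ↔ Fin (6 + m)
rowPositions m = mk↔ₛ′ pos elt pos-elt elt-pos
  where
  pos : Fin 3 ⊎ Fin (3 + m) → Fin (6 + m)
  pos (inj₁ 0F) = zero
  pos (inj₁ 1F) = suc (suc zero)
  pos (inj₁ 2F) = suc (suc (suc (suc zero)))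
  pos (inj₂ zero) = suc zero
  pos (inj₂ (suc zero)) = suc (suc (suc zero))
  pos (inj₂ (suc (suc i))) = suc (suc (suc (suc (suc i))))
  elt : Fin (6 + m) → Fin 3 ⊎ Fin (3 + m)
  elt zero = inj₁ 0F
  elt (suc zero) = inj₂ zero
  elt (suc (suc zero)) = inj₁ 1F
  elt (suc (suc (suc zero))) = inj₂ (suc zero)
  elt (suc (suc (suc (suc zero)))) = inj₁ 2F
  elt (suc (suc (suc (suc (suc i))))) = inj₂ (suc (suc i))
  pos-elt : ∀ i → pos (elt i) ≡ i
  pos-elt zero = refl
  pos-elt (suc zero) = refl
  pos-elt (suc (suc zero)) = refl
  pos-elt (suc (suc (suc zero))) = refl
  pos-elt (suc (suc (suc (suc zero)))) = refl
  pos-elt (suc (suc (suc (suc (suc i))))) = refl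
  elt-pos : ∀ r → elt (pos r) ≡ r
  elt-pos (inj₁ 0F) = refl
  elt-pos (inj₁ 1F) = refl
  elt-pos (inj₁ 2F) = refl
  elt-pos (inj₂ zero) = refl
  elt-pos (inj₂ (suc zero)) = refl
  elt-pos (inj₂ (suc (suc i))) = refl

colPositions : ∀ l → (Bool ⊎ Fin (2 + l)) ↔ Fin (4 + l)
colPositions l = mk↔ₛ′ pos elt pos-elt elt-pos
  where
  pos : Bool ⊎ Fin (2 + l) → Fin (4 + l)
  pos (inj₁ false) = zero
  pos (inj₁ true)  = suc (suc zero)
  pos (inj₂ zero)  = suc zero
  pos (inj₂ (suc i)) = suc (suc (suc i))
  elt : Fin (4 + l) → Bool ⊎ Fin (2 + l)
  elt zero = inj₁ false
  elt (suc zero) = inj₂ zero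
  elt (suc (suc zero)) = inj₁ true
  elt (suc (suc (suc i))) = inj₂ (suc i)
  pos-elt : ∀ i → pos (elt i) ≡ i
  pos-elt zero = refl
  pos-elt (suc zero) = refl
  pos-elt (suc (suc zero)) = refl
  pos-elt (suc (suc (suc i))) = refl
  elt-pos : ∀ r → elt (pos r) ≡ r
  elt-pos (inj₁ false) = refl
  elt-pos (inj₁ true) = refl
  elt-pos (inj₂ zero) = refl
  elt-pos (inj₂ (suc i)) = refl

rowCycle : ∀ m → MarkedCycle (Fin 3) (Fin (3 + m))
rowCycle m = markedCycle (rowPositions m) λ { 0F → _ , refl ; 1F → _ , refl ; 2F → _ , refl }

colCycle : ∀ l → MarkedCycle Bool (Fin (2 + l))
colCycle l = markedCycle (colPositions l) λ { false → _ , refl ; true → _ , refl }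

-- K₆ on the torus with a hexagonal face

I : Set
I = Fin 3 × Bool

inc dec : Fin 3 → Fin 3
inc 0F = 1F
inc 1F = 2F
inc 2F = 0F
dec 0F = 2F
dec 1F = 0F
dec 2F = 1F

-- Z/6 is written as Z/3 × Z/2, and move δᵢ adds i. At each vertex the neighbours come in
-- the order δ₅ δ₃ δ₂ δ₄ δ₁, with the hexagonal face between δ₁ and δ₅; this is the
-- seven-vertex torus with one vertex deleted.
data Δ : Set where
  δ₁ δ₂ δ₃ δ₄ δ₅ : Δ

move : Δ → I → I
move δ₁ (k , x) = inc k , not x
move δ₂ (k , x) = dec k , x
move δ₃ (k , x) = k , not x
move δ₄ (k , x) = inc k , x
move δ₅ (k , x) = dec k , not x

opp : Δ → Δ
opp δ₁ = δ₅
opp δ₂ = δ₄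
opp δ₃ = δ₃
opp δ₄ = δ₂
opp δ₅ = δ₁

-- Subtraction mod 3: `diff k k′` stands for k′ - k.
diff : Fin 3 → Fin 3 → Fin 3
diff 0F k = k
diff 1F k = dec k
diff 2F k = inc k

-- The Chinese remainder theorem: a residue mod 3 and a parity give a difference mod 6, with
-- `nothing` for difference 0.
classify : Fin 3 → Bool → Maybe Δ
classify 0F false = nothing
classify 0F true  = just δ₃
classify 1F false = just δ₄
classify 1F true  = just δ₁
classify 2F false = just δ₂
classify 2F true  = just δ₅

delta : I → I → Maybe Δ
delta (k , x) (k′ , x′) = classify (diff k k′) (x xor x′)

inc-dec : ∀ k → inc (dec k) ≡ k
inc-dec 0F = refl
inc-dec 1F = refl
inc-dec 2F = refl

dec-inc : ∀ k → dec (inc k) ≡ k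
dec-inc 0F = refl
dec-inc 1F = refl
dec-inc 2F = refl

diff-same : ∀ k → diff k k ≡ 0F
diff-same 0F = refl
diff-same 1F = refl
diff-same 2F = refl

diff-inc : ∀ k → diff k (inc k) ≡ 1F
diff-inc 0F = refl
diff-inc 1F = refl
diff-inc 2F = refl

diff-dec : ∀ k → diff k (dec k) ≡ 2F
diff-dec 0F = refl
diff-dec 1F = refl
diff-dec 2F = refl

xor-not : ∀ x → x xor not x ≡ true
xor-not false = refl
xor-not true  = refl

delta-self : ∀ i → delta i i ≡ nothing
delta-self (k , x) rewrite diff-same k | Bool.xor-same x = refl

delta-move : ∀ δ i → delta i (move δ i) ≡ just δ
delta-move δ₁ (k , x) rewrite diff-inc k  | xor-not x = refl
delta-move δ₂ (k , x) rewrite diff-dec k  | Bool.xor-same x = refl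
delta-move δ₃ (k , x) rewrite diff-same k | xor-not x = refl
delta-move δ₄ (k , x) rewrite diff-inc k  | Bool.xor-same x = refl
delta-move δ₅ (k , x) rewrite diff-dec k  | xor-not x = refl

move-opp : ∀ δ i → move (opp δ) (move δ i) ≡ i
move-opp δ₁ (k , x) = cong₂ _,_ (dec-inc k) (not-involutive x)
move-opp δ₂ (k , x) = cong (_, x) (inc-dec k)
move-opp δ₃ (k , x) = cong (k ,_) (not-involutive x)
move-opp δ₄ (k , x) = cong (_, x) (dec-inc k)
move-opp δ₅ (k , x) = cong₂ _,_ (inc-dec k) (not-involutive x)

delta-back : ∀ δ i → delta (move δ i) i ≡ just (opp δ)
delta-back δ i = subst (λ j → delta (move δ i) j ≡ just (opp δ)) (move-opp δ i)
  (delta-move (opp δ) (move δ i))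

-- A view that reduces the pairs of vertices of K₆ to six cases, so that `delta` need not be
-- computed on all 36.
data Position (i : I) : I → Set where
  self  : Position i i
  moved : ∀ δ → Position i (move δ i)

residue : ∀ k k′ → k′ ≡ k ⊎ k′ ≡ inc k ⊎ k′ ≡ dec k
residue 0F 0F = inj₁ refl
residue 0F 1F = inj₂ (inj₁ refl)
residue 0F 2F = inj₂ (inj₂ refl)
residue 1F 0F = inj₂ (inj₂ refl)
residue 1F 1F = inj₁ refl
residue 1F 2F = inj₂ (inj₁ refl)
residue 2F 0F = inj₂ (inj₁ refl)
residue 2F 1F = inj₂ (inj₂ refl)
residue 2F 2F = inj₁ refl

parity : ∀ x x′ → x′ ≡ x ⊎ x′ ≡ not x
parity false false = inj₁ refl
parity false true  = inj₂ refl
parity true  false = inj₂ refl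
parity true  true  = inj₁ refl

position : ∀ i j → Position i j
position (k , x) (k′ , x′) with k′ | residue k k′ | x′ | parity x x′
... | _ | inj₁ refl        | _ | inj₁ refl = self
... | _ | inj₁ refl        | _ | inj₂ refl = moved δ₃
... | _ | inj₂ (inj₁ refl) | _ | inj₁ refl = moved δ₄
... | _ | inj₂ (inj₁ refl) | _ | inj₂ refl = moved δ₁
... | _ | inj₂ (inj₂ refl) | _ | inj₁ refl = moved δ₂
... | _ | inj₂ (inj₂ refl) | _ | inj₂ refl = moved δ₅

-- The rotation system of the glued map

pattern a r x = inj₁ (r , x)
pattern b c y = inj₂ (c , y)

module GluedMap {m l : ℕ} (rows : MarkedCycle (Fin 3) (Fin m)) (cols : MarkedCycle Bool (Fin l)) where

  private
    module R = MarkedCycle rows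
    module C = MarkedCycle cols

  Row Col V : Set
  Row = Fin 3 ⊎ Fin m
  Col = Bool ⊎ Fin l
  V   = (Row × Bool) ⊎ (Col × Bool)

  vtx : I → V
  vtx i = a (inj₁ (proj₁ i)) (proj₂ i)

  -- a r true follows a r false in the cyclic order of the first class, and likewise for b.
  -- The vertices of K₆ are the a r x with r marked.
  adj : V → V → Bool
  adj (a (inj₁ k) x) (a (inj₁ k′) x′) = is-just (delta (k , x) (k′ , x′))
  adj (a (inj₁ _) _) (a (inj₂ _) _)   = false
  adj (a (inj₂ _) _) (a _ _)          = false
  adj (a _ _) (b _ _) = true
  adj (b _ _) (a _ _) = true
  adj (b _ _) (b _ _) = false

  -- Each of the six quadrangles with marked row and column receives one vertex of K₆: `(k , x)`
  -- goes into `X (inj₁ k) (inj₁ x)`, so its bit doubles as a marked column. There the rotation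
  -- enters K₆ along `δ₅`; every other corner is left as in Ringel's embedding.
  corner : Row → Bool → Col → V
  corner (inj₁ k) x (inj₁ z) = if x xor z then b (inj₁ z) (not x) else vtx (move δ₅ (k , x))
  corner (inj₁ k) x (inj₂ j) = b (inj₂ j) (not x)
  corner (inj₂ _) x c        = b c (not x)

  -- The rotation of K₆ cut open at the hexagon. After `δ₁` it returns to the vertex that would have
  -- come next without the insertion.
  turn : Δ → I → V
  turn δ₅ i = vtx (move δ₃ i)
  turn δ₃ i = vtx (move δ₂ i)
  turn δ₂ i = vtx (move δ₄ i)
  turn δ₄ i = vtx (move δ₁ i)
  turn δ₁ i = b (inj₁ (proj₂ i)) (not (proj₂ i))

  -- The bit of a vertex sets the direction in which it runs through the other class: `a r false`
  -- and `b c true` go forwards, the others backwards. The last clause is a filler for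
  -- non-neighbours.
  rotV : V → V → V
  rotV (a r x) (b c y) = if x xor y then b (C.shift y c) (not y) else corner r x c
  rotV (b c y) (a r x) = a (if x xor y then r else R.shift y r) (not x)
  rotV (a (inj₁ k) x) (a (inj₁ k′) x′) =
    maybe′ (λ δ → turn δ (k , x)) (a (inj₁ k) x) (delta (k , x) (k′ , x′))
  rotV v _ = v

  nextV : V × V → V × V
  nextV (v , w) = w , rotV w v

  data DartV : V → V → Set where
    ab : ∀ r x c y → DartV (a r x) (b c y)
    ba : ∀ c y r x → DartV (b c y) (a r x)
    aa : ∀ δ i → DartV (vtx i) (vtx (move δ i))

  dartV : ∀ v w → adj v w ≡ true → DartV v w
  dartV (a r x) (b c y) _ = ab r x c y
  dartV (b c y) (a r x) _ = ba c y r x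
  dartV (a (inj₁ k) x) (a (inj₁ k′) x′) p with position (k , x) (k′ , x′)
  ... | moved δ = aa δ (k , x)
  ... | self rewrite delta-self (k , x) with () ← p
  dartV (a (inj₁ _) _) (a (inj₂ _) _) ()
  dartV (a (inj₂ _) _) (a _ _) ()

  adj-vtx : ∀ δ i → adj (vtx i) (vtx (move δ i)) ≡ true
  adj-vtx δ i rewrite delta-move δ i = refl

  adj-irrefl : ∀ v → adj v v ≡ false
  adj-irrefl (a (inj₁ k) x) rewrite delta-self (k , x) = refl
  adj-irrefl (a (inj₂ _) _) = refl
  adj-irrefl (b _ _)        = refl

  adj-sym : ∀ v w → adj v w ≡ adj w v
  adj-sym (a (inj₁ k) x) (a (inj₁ k′) x′) with position (k , x) (k′ , x′)
  ... | self = refl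
  ... | moved δ rewrite delta-move δ (k , x) | delta-back δ (k , x) = refl
  adj-sym (a (inj₁ _) _) (a (inj₂ _) _) = refl
  adj-sym (a (inj₂ _) _) (a (inj₁ _) _) = refl
  adj-sym (a (inj₂ _) _) (a (inj₂ _) _) = refl
  adj-sym (a (inj₁ _) _) (b _ _) = refl
  adj-sym (a (inj₂ _) _) (b _ _) = refl
  adj-sym (b _ _) (a (inj₁ _) _) = refl
  adj-sym (b _ _) (a (inj₂ _) _) = refl
  adj-sym (b _ _) (b _ _) = refl

  adj-ab : ∀ r x c y → adj (a r x) (b c y) ≡ true
  adj-ab (inj₁ _) x c y = refl
  adj-ab (inj₂ _) x c y = refl

  rotV-vtx : ∀ δ i → rotV (vtx i) (vtx (move δ i)) ≡ turn δ i
  rotV-vtx δ i rewrite delta-move δ i = refl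

  rotV-vtx-back : ∀ δ i → rotV (vtx (move δ i)) (vtx i) ≡ turn (opp δ) (move δ i)
  rotV-vtx-back δ i rewrite delta-back δ i = refl

  adj-turn : ∀ δ i → adj (vtx i) (turn δ i) ≡ true
  adj-turn δ₁ i = refl
  adj-turn δ₂ i = adj-vtx δ₄ i
  adj-turn δ₃ i = adj-vtx δ₂ i
  adj-turn δ₄ i = adj-vtx δ₁ i
  adj-turn δ₅ i = adj-vtx δ₃ i

  adj-corner : ∀ r x c → adj (a r x) (corner r x c) ≡ true
  adj-corner (inj₁ k) x (inj₁ z) with x xor z
  ... | true  = refl
  ... | false = adj-vtx δ₅ (k , x)
  adj-corner (inj₁ k) x (inj₂ j) = refl
  adj-corner (inj₂ _) x c        = refl

  rotV-closed : ∀ v w → adj v w ≡ true → adj v (rotV v w) ≡ true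
  rotV-closed v w p with dartV v w p
  ... | aa δ i rewrite rotV-vtx δ i = adj-turn δ i
  ... | ba c y r x = refl
  ... | ab r x c y with x xor y
  ...   | true  = adj-ab r x _ _
  ...   | false = adj-corner r x c

  -- The rotation around every vertex is a single cycle

  flip-b : ∀ c y r → rotV (b c y) (a r (not y)) ≡ a r y
  flip-b c true  r = refl
  flip-b c false r = refl

  advance-b : ∀ c y r → rotV (b c y) (a r y) ≡ a (R.shift y r) (not y)
  advance-b c y r rewrite Bool.xor-same y = refl

  advance-a : ∀ r x c → rotV (a r x) (b c (not x)) ≡ b (C.shift (not x) c) x
  advance-a r true  c = refl
  advance-a r false c = refl

  -- Two rotation steps advance one row, so reachability lifts from the cycle of rows.
  around-b : ∀ c y r r′ → Reach (rotV (b c y)) (a r (not y)) (a r′ (not y))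
  around-b c y r r′ = Reach-lift (λ r → a r (not y))
    (λ r → once (flip-b c y r) ▷ advance-b c y r) (R.shift-reach y r r′)

  to-a : ∀ c y r r′ x → Reach (rotV (b c y)) (a r x) (a r′ (not y))
  to-a c y r r′ x with parity y x
  ... | inj₁ refl = once (advance-b c y r) ▷▷ around-b c y _ r′
  ... | inj₂ refl = around-b c y r r′

  reach-a : ∀ c y r r′ x x′ → Reach (rotV (b c y)) (a r x) (a r′ x′)
  reach-a c y r r′ x x′ with parity y x′
  ... | inj₁ refl = to-a c y r r′ x ▷ flip-b c y r′
  ... | inj₂ refl = to-a c y r r′ x

  rotV-corner : ∀ r x c → rotV (a r x) (b c x) ≡ corner r x c
  rotV-corner r x c rewrite Bool.xor-same x = refl

  module _ (i : I) where

    rotV-first : rotV (vtx i) (b (inj₁ (proj₂ i)) (proj₂ i)) ≡ vtx (move δ₅ i)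
    rotV-first rewrite Bool.xor-same (proj₂ i) = refl

    enter-vtx : ∀ δ → Reach (rotV (vtx i)) (b (inj₁ (proj₂ i)) (proj₂ i)) (vtx (move δ i))
    enter-vtx δ₅ = once rotV-first
    enter-vtx δ₃ = once rotV-first ▷ rotV-vtx δ₅ i
    enter-vtx δ₂ = once rotV-first ▷ rotV-vtx δ₅ i ▷ rotV-vtx δ₃ i
    enter-vtx δ₄ = once rotV-first ▷ rotV-vtx δ₅ i ▷ rotV-vtx δ₃ i ▷ rotV-vtx δ₂ i
    enter-vtx δ₁ = once rotV-first ▷ rotV-vtx δ₅ i ▷ rotV-vtx δ₃ i ▷ rotV-vtx δ₂ i ▷ rotV-vtx δ₄ i

    leave-vtx : ∀ δ → Reach (rotV (vtx i)) (vtx (move δ i)) (b (inj₁ (proj₂ i)) (not (proj₂ i)))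
    leave-vtx δ₁ = once (rotV-vtx δ₁ i)
    leave-vtx δ₄ = once (rotV-vtx δ₄ i) ▷ rotV-vtx δ₁ i
    leave-vtx δ₂ = once (rotV-vtx δ₂ i) ▷ rotV-vtx δ₄ i ▷ rotV-vtx δ₁ i
    leave-vtx δ₃ = once (rotV-vtx δ₃ i) ▷ rotV-vtx δ₂ i ▷ rotV-vtx δ₄ i ▷ rotV-vtx δ₁ i
    leave-vtx δ₅ = once (rotV-vtx δ₅ i) ▷ rotV-vtx δ₃ i ▷ rotV-vtx δ₂ i ▷ rotV-vtx δ₄ i ▷ rotV-vtx δ₁ i

  corner-plain : ∀ k x → corner (inj₁ k) x (inj₁ (not x)) ≡ b (inj₁ (not x)) (not x)
  corner-plain k x rewrite xor-not x = refl

  -- One step at an ordinary corner; at a glued one the rotation first passes through all five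
  -- neighbours in K₆.
  cross-corner : ∀ r x c → Reach (rotV (a r x)) (b c x) (b c (not x))
  cross-corner (inj₂ j) x c        = once (rotV-corner (inj₂ j) x c)
  cross-corner (inj₁ k) x (inj₂ j) = once (rotV-corner (inj₁ k) x (inj₂ j))
  cross-corner (inj₁ k) x (inj₁ z) with parity x z
  ... | inj₁ refl = enter-vtx (k , x) δ₁ ▷▷ leave-vtx (k , x) δ₁
  ... | inj₂ refl = once (trans (rotV-corner (inj₁ k) x (inj₁ z)) (corner-plain k x))

  module _ (r : Row) (x : Bool) where

    around-a : ∀ c c′ → Reach (rotV (a r x)) (b c x) (b c′ x)
    around-a c c′ = Reach-lift (λ c → b c x)
      (λ c → cross-corner r x c ▷ advance-a r x c) (C.shift-reach (not x) c c′)

    to-hub : ∀ w → adj (a r x) w ≡ true → ∀ c′ → Reach (rotV (a r x)) w (b c′ x)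
    to-hub w p c′ with dartV (a r x) w p
    ... | aa δ i = leave-vtx i δ ▷ advance-a r x _ ▷▷ around-a _ c′
    ... | ab _ _ c y with parity x y
    ...   | inj₁ refl = around-a c c′
    ...   | inj₂ refl = once (advance-a r x c) ▷▷ around-a _ c′

    -- The vertices `b c x` serve as hubs: every neighbour leads to each of them, and every
    -- neighbour is reached from one.
    reach-neighbour : ∀ w w′ → adj (a r x) w ≡ true → adj (a r x) w′ ≡ true →
                      Reach (rotV (a r x)) w w′
    reach-neighbour w w′ p p′ with dartV (a r x) w′ p′
    ... | aa δ i = to-hub w p (inj₁ x) ▷▷ enter-vtx i δ
    ... | ab _ _ c y with parity x y
    ...   | inj₁ refl = to-hub w p c
    ...   | inj₂ refl = to-hub w p c ▷▷ cross-corner r x c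

  rotV-cyclic : ∀ v w w′ → adj v w ≡ true → adj v w′ ≡ true → Reach (rotV v) w w′
  rotV-cyclic (a r x) w w′ p p′ = reach-neighbour r x w w′ p p′
  rotV-cyclic (b c y) (a r x) (a r′ x′) p p′ = reach-a c y r r′ x x′

  -- Faces

  -- X r c has vertices a r x, b c y, and Y r c lies in the gaps after a r true and b c true.
  -- T i is the triangle i, i + 1, i + 4, and U x is the triangle of the i ≡ x mod 2.
  -- X r c with r and c both marked is absorbed by F.
  data Label : Set where
    X Y : Row → Col → Label
    T   : I → Label
    U   : Bool → Label
    F   : Label

  quad : Row → Col → Label
  quad (inj₁ _) (inj₁ _) = F
  quad (inj₁ k) (inj₂ j) = X (inj₁ k) (inj₂ j)
  quad (inj₂ j) c        = X (inj₂ j) c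

  -- `T i` has the sides `δ₁` from i, `δ₃` from i + 1 and `δ₂` from i + 4, whence the shifts back by
  -- 1 and 4. The sides of `U x` are all `δ₄`, those of the hexagon all `δ₅`.
  triangle : Δ → I → Label
  triangle δ₁ i       = T i
  triangle δ₂ (k , x) = T (dec k , x)
  triangle δ₃ (k , x) = T (dec k , not x)
  triangle δ₄ (k , x) = U x
  triangle δ₅ _       = F

  -- An edge between the classes has `quad r c` on one side and, on the other, the `Y` in the gaps
  -- beside its ends. Comparing the bits tells which direction carries which.
  label : V → V → Label
  label (a r x) (b c y) = if x xor y then quad r c else Y (R.gap x r) (C.gap y c)
  label (b c y) (a r x) = if x xor y then Y (R.gap x r) (C.gap y c) else quad r c
  label (a (inj₁ k) x) (a (inj₁ k′) x′) = maybe′ (λ δ → triangle δ (k , x)) F (delta (k , x) (k′ , x′))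
  label _ _ = F

  label-vtx : ∀ δ i → label (vtx i) (vtx (move δ i)) ≡ triangle δ i
  label-vtx δ i rewrite delta-move δ i = refl

  label-vtx-back : ∀ δ i → label (vtx (move δ i)) (vtx i) ≡ triangle (opp δ) (move δ i)
  label-vtx-back δ i rewrite delta-back δ i = refl

  -- Face tracing sends `δ₁` to `δ₃` to `δ₂` to `δ₁` around `T`, and `δ₄` to `δ₄` around `U`; after
  -- `δ₅` it enters a glued quadrangle, still on `F`.
  label-turn : ∀ δ i → label (vtx (move δ i)) (turn (opp δ) (move δ i)) ≡ triangle δ i
  label-turn δ₁ (k , x) = trans (label-vtx δ₃ _) (cong₂ (λ k x → T (k , x)) (dec-inc k) (not-involutive x))
  label-turn δ₂ (k , x) = label-vtx δ₁ (dec k , x)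
  label-turn δ₃ (k , x) = label-vtx δ₂ (k , not x)
  label-turn δ₄ (k , x) = label-vtx δ₄ (inc k , x)
  label-turn δ₅ (k , false) = refl
  label-turn δ₅ (k , true)  = refl

  label-corner : ∀ r x c → label (a r x) (corner r x c) ≡ quad r c
  label-corner (inj₂ _) false c        = refl
  label-corner (inj₂ _) true  c        = refl
  label-corner (inj₁ _) false (inj₂ _) = refl
  label-corner (inj₁ _) true  (inj₂ _) = refl
  label-corner (inj₁ k) false (inj₁ true)  = refl
  label-corner (inj₁ k) false (inj₁ false) = label-vtx δ₅ (k , false)
  label-corner (inj₁ k) true  (inj₁ true)  = label-vtx δ₅ (k , true)
  label-corner (inj₁ k) true  (inj₁ false) = refl

  -- Labels are constant along faces. Together with `reach-rep` this identifies the faces with the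
  -- labels that occur.
  label-next : ∀ {v w} → DartV v w → label w (rotV w v) ≡ label v w
  label-next (ab r false c false) = refl
  label-next (ab r false c true)  = refl
  label-next (ab r true  c false) = refl
  label-next (ab r true  c true)  = cong (λ r → Y r c) (R.prev-next r)
  label-next (ba c false r false) = label-corner r false c
  label-next (ba c true  r false) = cong (Y (R.prev r)) (C.prev-next c)
  label-next (ba c false r true)  = refl
  label-next (ba c true  r true)  = label-corner r true c
  label-next (aa δ i) rewrite rotV-vtx-back δ i | label-vtx δ i = label-turn δ i

  rep : Label → V × V
  rep (X r c) = a r false , b c true
  rep (Y r c) = a r true , b c true
  rep (T i)   = vtx i , vtx (move δ₁ i)
  rep (U x)   = vtx (0F , x) , vtx (1F , x)
  rep F       = vtx (0F , false) , vtx (2F , true)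

  step-vtx : ∀ δ i → nextV (vtx i , vtx (move δ i)) ≡ (vtx (move δ i) , turn (opp δ) (move δ i))
  step-vtx δ i = cong (vtx (move δ i) ,_) (rotV-vtx-back δ i)

  reach-U : ∀ k x → Reach nextV (rep (U x)) (vtx (k , x) , vtx (inc k , x))
  reach-U 0F x = stay
  reach-U 1F x = once (step-vtx δ₄ (0F , x))
  reach-U 2F x = reach-U 1F x ▷ step-vtx δ₄ (1F , x)

  step-T : ∀ k x → nextV (rep (T (dec k , not x))) ≡ (vtx (k , x) , vtx (k , not x))
  step-T k x = trans (step-vtx δ₁ (dec k , not x))
    (cong₂ (λ k x → vtx (k , x) , vtx (k , not x)) (inc-dec k) (not-involutive x))

  step-T² : ∀ k x → nextV (nextV (rep (T (dec k , x)))) ≡ (vtx (k , x) , vtx (dec k , x))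
  step-T² k x = subst (λ z → nextV (nextV (rep (T (dec k , z)))) ≡ (vtx (k , z) , vtx (dec k , z)))
    (not-involutive x)
    (trans (cong nextV (step-T k (not x))) (step-vtx δ₃ (k , not x)))

  reach-triangle : ∀ δ i → δ ≢ δ₅ → Reach nextV (rep (triangle δ i)) (vtx i , vtx (move δ i))
  reach-triangle δ₁ i       _ = stay
  reach-triangle δ₂ (k , x) _ = 2 , step-T² k x
  reach-triangle δ₃ (k , x) _ = once (step-T k x)
  reach-triangle δ₄ (k , x) _ = reach-U k x
  reach-triangle δ₅ _ ¬F with () ← ¬F refl

  -- The face F runs along a side of the hexagon to a marked vertex, then once
  -- around the quadrangle glued there, then along the next side.

  around-quad : I → V × V
  around-quad i = vtx i , b (inj₁ (proj₂ i)) (not (proj₂ i))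

  exit-quad : ∀ i → Reach nextV (around-quad i) (vtx i , vtx (move δ₅ i))
  exit-quad (k , false) = 4 , refl
  exit-quad (k , true)  = 4 , refl

  -- `(2F , true)` is 5 in Z/6, where the side `rep F` from 0 ends. From there the hexagon descends
  -- through 4, 3, 2, 1 to 0.
  hexagon : ∀ i → Reach (move δ₅) (2F , true) i
  hexagon (2F , true)  = 0 , refl
  hexagon (1F , false) = 1 , refl
  hexagon (0F , true)  = 2 , refl
  hexagon (2F , false) = 3 , refl
  hexagon (1F , true)  = 4 , refl
  hexagon (0F , false) = 5 , refl

  reach-around-quad : ∀ i → Reach nextV (rep F) (around-quad i)
  reach-around-quad i = once (step-vtx δ₅ (0F , false)) ▷▷
    Reach-lift around-quad (λ i → exit-quad i ▷ step-vtx δ₅ i) (hexagon i)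

  reach-quad-ab : ∀ r x c → Reach nextV (rep (quad r c)) (a r x , b c (not x))
  reach-quad-ab (inj₁ k) false (inj₁ false) = reach-around-quad (k , false)
  -- This quadrangle is glued at its other vertex `(k , true)`; the dart wanted comes two sides
  -- later.
  reach-quad-ab (inj₁ k) false (inj₁ true)  = reach-around-quad (k , true) ▷▷ (2 , refl)
  reach-quad-ab (inj₁ k) true  (inj₁ false) = reach-around-quad (k , false) ▷▷ (2 , refl)
  reach-quad-ab (inj₁ k) true  (inj₁ true)  = reach-around-quad (k , true)
  reach-quad-ab (inj₁ k) false (inj₂ j)     = stay
  reach-quad-ab (inj₁ k) true  (inj₂ j)     = 2 , refl
  reach-quad-ab (inj₂ j) false c            = stay
  reach-quad-ab (inj₂ j) true  c            = 2 , refl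

  reach-quad-ba : ∀ r x c → Reach nextV (rep (quad r c)) (b c x , a r x)
  reach-quad-ba r false c = reach-quad-ab r true  c ▷ refl
  reach-quad-ba r true  c = reach-quad-ab r false c ▷ refl

  reach-rep : ∀ {v w} → DartV v w → Reach nextV (rep (label v w)) (v , w)
  reach-rep (ab r false c true)  = reach-quad-ab r false c
  reach-rep (ab r true  c false) = reach-quad-ab r true c
  reach-rep (ba c false r false) = reach-quad-ba r false c
  reach-rep (ba c true  r true)  = reach-quad-ba r true c
  -- The four sides of a `Y` quadrangle, zero to three steps after its representative.
  reach-rep (ab r true  c true)  = stay
  reach-rep (ba c true  r false) = 1 , cong (λ r → b c true , a r false) (R.next-prev r)
  reach-rep (ab r false c false) = 2 ,
    cong₂ (λ r c → a r false , b c false) (R.next-prev r) (C.next-prev c)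
  reach-rep (ba c false r true)  = 3 ,
    cong₂ (λ r c → b c false , a r true) (R.prev-next r) (C.next-prev c)
  reach-rep (aa δ i) rewrite label-vtx δ i with δ
  ... | δ₁ = reach-triangle δ₁ i λ ()
  ... | δ₂ = reach-triangle δ₂ i λ ()
  ... | δ₃ = reach-triangle δ₃ i λ ()
  ... | δ₄ = reach-triangle δ₄ i λ ()
  ... | δ₅ = reach-around-quad i ▷▷ exit-quad i

  -- The dual is simple: an edge is determined by the labels of its two sides

  _≟ᴿ_ : DecidableEquality Row
  _≟ᴿ_ = ≡-dec Fin._≟_ Fin._≟_

  _≟ᶜ_ : DecidableEquality Col
  _≟ᶜ_ = ≡-dec Bool._≟_ Fin._≟_

  -- Of the two directions of the edge, the one labelled `quad r c`.
  orient : Row → Bool → Col → Bool → V × V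
  orient r x c y = if x xor y then (a r x , b c y) else (b c y , a r x)

  between : Row → Col → Row → Col → V × V
  between r c r′ c′ = orient r (does (r′ ≟ᴿ r)) c (does (c′ ≟ᶜ c))

  -- A left inverse to taking the labels of a dart and its reverse. For `F` against a `Y`,
  -- `nearMark` finds which glued quadrangle is involved. The last clause is a filler.
  edge : Label → Label → V × V
  edge (X r c) (Y r′ c′) = between r c r′ c′
  edge (Y r′ c′) (X r c) = swap (between r c r′ c′)
  edge F (Y r′ c′) = between (R.nearMark r′) (C.nearMark c′) r′ c′
  edge (Y r′ c′) F = swap (between (R.nearMark r′) (C.nearMark c′) r′ c′)
  edge F (T i) = vtx (move δ₁ i) , vtx i
  edge (T i) F = vtx i , vtx (move δ₁ i)
  edge (U _) (T i) = vtx i , vtx (move δ₄ i)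
  edge (T i) (U _) = vtx (move δ₄ i) , vtx i
  -- The only `T` that `T i` borders is `T (i + 3)`, across a `δ₃` edge.
  edge (T (k , x)) (T _) = vtx (inc k , not x) , vtx (inc k , x)
  edge L _ = rep L

  between-gap : ∀ r x c y → between r c (R.gap x r) (C.gap y c) ≡ orient r x c y
  between-gap r x c y rewrite R.gap-side _≟ᴿ_ x r | C.gap-side _≟ᶜ_ y c = refl

  edge-quad : ∀ r x c y → edge (quad r c) (Y (R.gap x r) (C.gap y c)) ≡ orient r x c y
  edge-quad (inj₁ k) x (inj₁ z) y rewrite R.nearMark-gap x k | C.nearMark-gap y z = between-gap (inj₁ k) x (inj₁ z) y
  edge-quad (inj₁ k) x (inj₂ j) y = between-gap (inj₁ k) x (inj₂ j) y
  edge-quad (inj₂ j) x c        y = between-gap (inj₂ j) x c y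

  edge-quad′ : ∀ r x c y → edge (Y (R.gap x r) (C.gap y c)) (quad r c) ≡ swap (orient r x c y)
  edge-quad′ (inj₁ k) x (inj₁ z) y rewrite R.nearMark-gap x k | C.nearMark-gap y z = cong swap (between-gap (inj₁ k) x (inj₁ z) y)
  edge-quad′ (inj₁ k) x (inj₂ j) y = cong swap (between-gap (inj₁ k) x (inj₂ j) y)
  edge-quad′ (inj₂ j) x c        y = cong swap (between-gap (inj₂ j) x c y)

  edge-vtx : ∀ δ i → edge (triangle δ i) (triangle (opp δ) (move δ i)) ≡ (vtx i , vtx (move δ i))
  edge-vtx δ₁ i = refl
  edge-vtx δ₂ (k , x) = cong (λ k′ → vtx (k′ , x) , vtx (dec k , x)) (inc-dec k)
  edge-vtx δ₃ (k , x) = cong₂ (λ k′ x′ → vtx (k′ , x′) , vtx (k′ , not x)) (inc-dec k) (not-involutive x)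
  edge-vtx δ₄ (k , x) = cong (λ k′ → vtx (k′ , x) , vtx (inc k′ , x)) (dec-inc k)
  edge-vtx δ₅ (k , x) = cong₂ (λ k′ x′ → vtx (k′ , x′) , vtx (dec k , not x)) (inc-dec k) (not-involutive x)

  edge-label : ∀ {v w} → DartV v w → edge (label v w) (label w v) ≡ (v , w)
  edge-label (ab r false c true)  = edge-quad r false c true
  edge-label (ab r true  c false) = edge-quad r true c false
  edge-label (ba c false r false) = edge-quad r false c false
  edge-label (ba c true  r true)  = edge-quad r true c true
  edge-label (ab r false c false) = edge-quad′ r false c false
  edge-label (ab r true  c true)  = edge-quad′ r true c true
  edge-label (ba c true  r false) = edge-quad′ r false c true
  edge-label (ba c false r true)  = edge-quad′ r true c false
  edge-label (aa δ i) rewrite label-vtx δ i | label-vtx-back δ i = edge-vtx δ i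

  quad≢Y : ∀ r c {r′ c′} → quad r c ≢ Y r′ c′
  quad≢Y (inj₁ _) (inj₁ _) ()
  quad≢Y (inj₁ _) (inj₂ _) ()
  quad≢Y (inj₂ _) _ ()

  -- Only across `δ₃` are both faces of the same kind, and these two differ in parity.
  triangle-opp : ∀ δ i → triangle δ i ≢ triangle (opp δ) (move δ i)
  triangle-opp δ₃ (k , false) ()
  triangle-opp δ₃ (k , true)  ()

  label-rev : ∀ {v w} → DartV v w → label v w ≢ label w v
  label-rev (ab r false c true)  = quad≢Y r c
  label-rev (ab r true  c false) = quad≢Y r c
  label-rev (ba c false r false) = quad≢Y r c
  label-rev (ba c true  r true)  = quad≢Y r c
  label-rev (ab r false c false) = quad≢Y r c ∘ sym
  label-rev (ab r true  c true)  = quad≢Y r c ∘ sym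
  label-rev (ba c true  r false) = quad≢Y r c ∘ sym
  label-rev (ba c false r true)  = quad≢Y r c ∘ sym
  label-rev (aa δ i) rewrite label-vtx δ i | label-vtx-back δ i = triangle-opp δ i

  -- Separation of quadrangles from triangles by `F`

  data Quadrangle : Label → Set where
    isX : ∀ {r c} → Quadrangle (X r c)
    isY : ∀ {r c} → Quadrangle (Y r c)

  quad-cases : ∀ r c → Quadrangle (quad r c) ⊎ quad r c ≡ F
  quad-cases (inj₁ _) (inj₁ _) = inj₂ refl
  quad-cases (inj₁ _) (inj₂ _) = inj₁ isX
  quad-cases (inj₂ _) _        = inj₁ isX

  -- Edges of K₆ have no quadrangle on either side, and edges between the classes have no triangle,
  -- so the quadrangles can be left only into `F`.
  cross-quadrangle : ∀ {v w} → DartV v w → Quadrangle (label v w) →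
                     Quadrangle (label w v) ⊎ label w v ≡ F
  cross-quadrangle (ab r false c true)  _ = inj₁ isY
  cross-quadrangle (ab r true  c false) _ = inj₁ isY
  cross-quadrangle (ba c false r false) _ = inj₁ isY
  cross-quadrangle (ba c true  r true)  _ = inj₁ isY
  cross-quadrangle (ab r false c false) _ = quad-cases r c
  cross-quadrangle (ab r true  c true)  _ = quad-cases r c
  cross-quadrangle (ba c true  r false) _ = quad-cases r c
  cross-quadrangle (ba c false r true)  _ = quad-cases r c
  cross-quadrangle (aa δ i) q rewrite label-vtx δ i with δ
  ... | δ₁ with () ← q
  ... | δ₂ with () ← q
  ... | δ₃ with () ← q
  ... | δ₄ with () ← q
  ... | δ₅ with () ← q

-- Sums over `Fin` and small subsets

S : ∀ n → (Fin n → ℕ) → ℕ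
S n f = sum (tabulate f)

S-allFin : ∀ n (f : Fin n → ℕ) → sum (map f (allFin n)) ≡ S n f
S-allFin n f = cong sum (map-tabulate id f)

S-cong : ∀ {n} {f g : Fin n → ℕ} → (∀ i → f i ≡ g i) → S n f ≡ S n g
S-cong eq = cong sum (tabulate-cong eq)

S-const : ∀ n {c} {f : Fin n → ℕ} → (∀ i → f i ≡ c) → S n f ≡ n * c
S-const zero    eq = refl
S-const (suc n) eq = cong₂ _+_ (eq zero) (S-const n (eq ∘ suc))

S-zero : ∀ n {f : Fin n → ℕ} → (∀ i → f i ≡ 0) → S n f ≡ 0
S-zero n eq = trans (S-const n eq) (*-zeroʳ n)

S-+ : ∀ m n (f : Fin (m + n) → ℕ) → S (m + n) f ≡ S m (f ∘ (_↑ˡ n)) + S n (f ∘ (m ↑ʳ_))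
S-+ zero    n f = refl
S-+ (suc m) n f = trans (cong (f zero +_) (S-+ m n (f ∘ suc))) (sym (+-assoc (f zero) _ _))

S-+const : ∀ n {c} (f : Fin n → ℕ) → S n (λ i → f i + c) ≡ S n f + n * c
S-+const zero        f = refl
S-+const (suc n) {c} f = trans (cong (f zero + c +_) (S-+const n (f ∘ suc)))
  (interchange (f zero) c (S n (f ∘ suc)) (n * c))
  where
  interchange : ∀ w x y z → (w + x) + (y + z) ≡ (w + y) + (x + z)
  interchange = solve-∀

≤⇒≮ᵇ : ∀ {m n} → n ≤ m → (m <ᵇ n) ≡ false
≤⇒≮ᵇ z≤n       = refl
≤⇒≮ᵇ (s≤s n≤m) = ≤⇒≮ᵇ n≤m

∉-left : ∀ m {n} (s : Subset (m + n)) → ∣ s ∣ < m → ∃[ i ] (i ↑ˡ n) ∉ s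
∉-left (suc m) (outside ∷ s) _ = zero , λ ()
∉-left (suc m) (inside ∷ s) (s≤s lt) with ∉-left m s lt
... | i , i∉s = suc i , λ { (there i∈s) → i∉s i∈s }

∉-right : ∀ m {n} (s : Subset (m + n)) → ∣ s ∣ < n → ∃[ i ] (m ↑ʳ i) ∉ s
∉-right zero {n} s lt = go n s lt
  where
  go : ∀ n (s : Subset n) → ∣ s ∣ < n → ∃[ i ] i ∉ s
  go (suc n) (outside ∷ s) _ = zero , λ ()
  go (suc n) (inside ∷ s) (s≤s lt) with go n s lt
  ... | i , i∉s = suc i , λ { (there i∈s) → i∉s i∈s }
∉-right (suc m) (outside ∷ s) lt with ∉-right m s lt
... | i , i∉s = i , λ { (there i∈s) → i∉s i∈s }
∉-right (suc m) (inside ∷ s) lt with ∉-right m s (≤-trans (n≤1+n _) lt)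
... | i , i∉s = i , λ { (there i∈s) → i∉s i∈s }

-- The glued map as an `EmbeddedGraph`

module GluedGraph {m l : ℕ} (rows : MarkedCycle (Fin 3) (Fin m)) (cols : MarkedCycle Bool (Fin l)) where
  open GluedMap rows cols

  P Q A B : ℕ
  P = 3 + m
  Q = 2 + l
  A = P * 2
  B = Q * 2

  row↔ : Fin P ↔ Row
  row↔ = Fin.+↔⊎

  col↔ : Fin Q ↔ Col
  col↔ = ↔-trans (Fin.+↔⊎ {2}) (Fin.2↔Bool ⊎-↔ ↔-refl)

  a↔ : Fin A ↔ (Row × Bool)
  a↔ = ↔-trans (Fin.*↔× {P}) (row↔ ×-↔ Fin.2↔Bool)

  b↔ : Fin B ↔ (Col × Bool)
  b↔ = ↔-trans (Fin.*↔× {Q}) (col↔ ×-↔ Fin.2↔Bool)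

  vertex↔ : Fin (A + B) ↔ V
  vertex↔ = ↔-trans (Fin.+↔⊎ {A}) (a↔ ⊎-↔ b↔)

  open Inverse vertex↔ using (to; from) renaming (strictlyInverseˡ to to-from; strictlyInverseʳ to from-to)

  E° : Fin (A + B) → Fin (A + B) → Bool
  E° u w = adj (to u) (to w)

  left : Fin A → Fin (A + B)
  left i = i ↑ˡ B

  right : Fin B → Fin (A + B)
  right j = A ↑ʳ j

  to-left : ∀ i → to (left i) ≡ inj₁ (Inverse.to a↔ i)
  to-left i rewrite Fin.splitAt-↑ˡ A i B = refl

  to-right : ∀ j → to (right j) ≡ inj₂ (Inverse.to b↔ j)
  to-right j rewrite Fin.splitAt-↑ʳ A B j = refl

  adj-inj : ∀ p q → adj (inj₁ p) (inj₂ q) ≡ true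
  adj-inj (r , x) (c , y) = adj-ab r x c y

  module _ {Allowed : Fin (A + B) → Set} (i : Fin A) (j : Fin B)
           (okᵢ : Allowed (left i)) (okⱼ : Allowed (right j)) where

    -- The classes are completely joined: vertices of different classes are adjacent, and two of the
    -- same class have `left i` or `right j` as a common neighbour.
    walk : ∀ u w → Allowed w → Walk E° Allowed u w
    walk u w ok with to u in equ | to w in eqw
    ... | inj₁ p | inj₂ q = step here (trans (cong₂ adj equ eqw) (adj-inj p q)) ok
    ... | inj₂ q | inj₁ p = step here (trans (cong₂ adj equ eqw) refl) ok
    ... | inj₁ p | inj₁ p′ =
      step (step here (trans (cong₂ adj equ (to-right j)) (adj-inj p _)) okⱼ)
        (trans (cong₂ adj (to-right j) eqw) refl) ok
    ... | inj₂ q | inj₂ q′ =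
      step (step here (trans (cong₂ adj equ (to-left i)) refl) okᵢ)
        (trans (cong₂ adj (to-left i) eqw) (adj-inj (Inverse.to a↔ i) q′)) ok

  G : EmbeddedGraph
  G = record
    { n          = A + B
    ; E          = E°
    ; E-sym      = λ v w → adj-sym (to v) (to w)
    ; E-irrefl   = λ v → adj-irrefl (to v)
    ; rot        = λ v w → from (rotV (to v) (to w))
    ; rot-closed = λ v w p → trans (cong (adj (to v)) (to-from _)) (rotV-closed (to v) (to w) p)
    ; rot-cyclic = λ v w w′ p p′ →
        subst (Reach _ w) (from-to w′)
          (subst (λ z → Reach _ z (from (to w′))) (from-to w)
            (Reach-lift from (λ z → once (cong (from ∘ rotV (to v)) (to-from z)))
              (rotV-cyclic (to v) (to w) (to w′) p p′)))
    ; connected  = λ u w → walk {λ _ → ⊤} zero zero tt tt u w tt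
    }

  -- Deleting fewer than `c` vertices exhausts neither class, so `walk` applies to what remains.
  c-connected : ∀ {c} → c ≤ A → c ≤ B → Connectedness G c
  c-connected {c} c≤A c≤B =
    ≤-<-trans c≤A (m<m+n A (s≤s z≤n)) , λ s s<c u w _ w∉s →
      let i , i∉s = ∉-left A s (≤-trans s<c c≤A)
          j , j∉s = ∉-right A s (≤-trans s<c c≤B)
      in walk i j i∉s j∉s u w w∉s

  toD : Dart G → V × V
  toD (u , w) = to u , to w

  fromD : V × V → Dart G
  fromD (v , w) = from v , from w

  fromD-toD : ∀ d → fromD (toD d) ≡ d
  fromD-toD (u , w) = cong₂ _,_ (from-to u) (from-to w)

  toD-fromD : ∀ e → toD (fromD e) ≡ e
  toD-fromD (v , w) = cong₂ _,_ (to-from v) (to-from w)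

  faceNext-fromD : ∀ e → faceNext G (fromD e) ≡ fromD (nextV e)
  faceNext-fromD (v , w) = cong (from w ,_) (cong₂ (λ v w → from (rotV w v)) (to-from v) (to-from w))

  face : Dart G → Label
  face d = uncurry label (toD d)

  dart : ∀ {d} → IsDart G d → uncurry DartV (toD d)
  dart p = dartV _ _ p

  IsDart-rev : ∀ {d} → IsDart G d → IsDart G (rev G d)
  IsDart-rev {u , w} p = trans (adj-sym (to w) (to u)) p

  SameFace⇒face : ∀ {d d′} → IsDart G d → SameFace G d d′ → face d ≡ face d′
  SameFace⇒face {d} {d′} p reach = proj₂ (Reach-invariant (λ d′ → IsDart G d′ × face d ≡ face d′) next (p , refl) reach)
    where
    next : ∀ d′ → IsDart G d′ × face d ≡ face d′ →
           IsDart G (faceNext G d′) × face d ≡ face (faceNext G d′)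
    next (u , w) (q , eq) =
      trans (cong (adj (to w)) (to-from _)) (rotV-closed (to w) (to u) (IsDart-rev {u , w} q)) ,
      trans eq (sym (trans (cong (label (to w)) (to-from _)) (label-next (dart {u , w} q))))

  reach-face : ∀ d → IsDart G d → SameFace G (fromD (rep (face d))) d
  reach-face d p = subst (SameFace G _) (fromD-toD d)
    (Reach-lift fromD (λ e → once (faceNext-fromD e)) (reach-rep (dart {d} p)))

  adj-rep : ∀ L → uncurry adj (rep L) ≡ true
  adj-rep (X r c) = adj-ab r false c true
  adj-rep (Y r c) = adj-ab r true c true
  adj-rep (T i)   = adj-vtx δ₁ i
  adj-rep (U x)   = adj-vtx δ₄ (0F , x)
  adj-rep F       = adj-vtx δ₅ (0F , false)

  IsDart-rep : ∀ L → IsDart G (fromD (rep L))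
  IsDart-rep L = trans (cong (uncurry adj) (toD-fromD (rep L))) (adj-rep L)

  face-rep : ∀ L → face (fromD (rep L)) ≡ uncurry label (rep L)
  face-rep L = cong (uncurry label) (toD-fromD (rep L))

  -- Counting faces

  -- The six labels X r c with r and c both marked are free, so they number the triangles T.
  Slot : Set
  Slot = ((Row × Col) ⊎ (Row × Col)) ⊎ Fin 3

  slot↔ : Fin ((P * Q + P * Q) + 3) ↔ Slot
  slot↔ = ↔-trans (Fin.+↔⊎ {P * Q + P * Q})
    (↔-trans (Fin.+↔⊎ {P * Q}) (quads ⊎-↔ quads) ⊎-↔ ↔-refl)
    where
    quads : Fin (P * Q) ↔ (Row × Col)
    quads = ↔-trans (Fin.*↔× {P}) (row↔ ×-↔ col↔)

  fromSlot : Slot → Label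
  fromSlot (inj₁ (inj₁ (inj₁ k , inj₁ x))) = T (k , x)
  fromSlot (inj₁ (inj₁ (inj₁ k , inj₂ j))) = X (inj₁ k) (inj₂ j)
  fromSlot (inj₁ (inj₁ (inj₂ j , c)))      = X (inj₂ j) c
  fromSlot (inj₁ (inj₂ (r , c))) = Y r c
  fromSlot (inj₂ 0F) = F
  fromSlot (inj₂ 1F) = U false
  fromSlot (inj₂ 2F) = U true

  toSlot : Label → Slot
  toSlot (X r c)     = inj₁ (inj₁ (r , c))
  toSlot (T (k , x)) = inj₁ (inj₁ (inj₁ k , inj₁ x))
  toSlot (Y r c)     = inj₁ (inj₂ (r , c))
  toSlot F           = inj₂ 0F
  toSlot (U false)   = inj₂ 1F
  toSlot (U true)    = inj₂ 2F

  toSlot-fromSlot : ∀ s → toSlot (fromSlot s) ≡ s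
  toSlot-fromSlot (inj₁ (inj₁ (inj₁ k , inj₁ x))) = refl
  toSlot-fromSlot (inj₁ (inj₁ (inj₁ k , inj₂ j))) = refl
  toSlot-fromSlot (inj₁ (inj₁ (inj₂ j , c)))      = refl
  toSlot-fromSlot (inj₁ (inj₂ (r , c))) = refl
  toSlot-fromSlot (inj₂ 0F) = refl
  toSlot-fromSlot (inj₂ 1F) = refl
  toSlot-fromSlot (inj₂ 2F) = refl

  label-rep : ∀ s → uncurry label (rep (fromSlot s)) ≡ fromSlot s
  label-rep (inj₁ (inj₁ (inj₁ k , inj₁ x))) = label-vtx δ₁ (k , x)
  label-rep (inj₁ (inj₁ (inj₁ k , inj₂ j))) = refl
  label-rep (inj₁ (inj₁ (inj₂ j , c)))      = refl
  label-rep (inj₁ (inj₂ (r , c))) = refl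
  label-rep (inj₂ 0F) = refl
  label-rep (inj₂ 1F) = refl
  label-rep (inj₂ 2F) = refl

  fromSlot-quad : ∀ r c → fromSlot (toSlot (quad r c)) ≡ quad r c
  fromSlot-quad (inj₁ _) (inj₁ _) = refl
  fromSlot-quad (inj₁ _) (inj₂ _) = refl
  fromSlot-quad (inj₂ _) _        = refl

  fromSlot-triangle : ∀ δ i → fromSlot (toSlot (triangle δ i)) ≡ triangle δ i
  fromSlot-triangle δ₁ i = refl
  fromSlot-triangle δ₂ i = refl
  fromSlot-triangle δ₃ i = refl
  fromSlot-triangle δ₄ (k , false) = refl
  fromSlot-triangle δ₄ (k , true)  = refl
  fromSlot-triangle δ₅ i = refl

  -- `toSlot` confuses `T (k , x)` with `X (inj₁ k) (inj₁ x)`, but the latter never occurs as the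
  -- label of a dart.
  fromSlot-label : ∀ {v w} → DartV v w → fromSlot (toSlot (label v w)) ≡ label v w
  fromSlot-label (ab r x c y) with x xor y
  ... | true  = fromSlot-quad r c
  ... | false = refl
  fromSlot-label (ba c y r x) with x xor y
  ... | true  = refl
  ... | false = fromSlot-quad r c
  fromSlot-label (aa δ i) rewrite label-vtx δ i = fromSlot-triangle δ i

  faceCount : FaceCount G ((P * Q + P * Q) + 3)
  faceCount = repF , (λ i → IsDart-rep (lab i)) , λ d p → ix d , reach d p , unique d p
    where
    module I = Inverse slot↔
    lab : Fin ((P * Q + P * Q) + 3) → Label
    lab i = fromSlot (I.to i)
    repF : Fin ((P * Q + P * Q) + 3) → Dart G
    repF i = fromD (rep (lab i))
    ix : Dart G → Fin ((P * Q + P * Q) + 3)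
    ix d = I.from (toSlot (face d))
    lab-ix : ∀ d → IsDart G d → lab (ix d) ≡ face d
    lab-ix d p = trans (cong fromSlot (I.strictlyInverseˡ _)) (fromSlot-label (dart {d} p))
    reach : ∀ d → IsDart G d → SameFace G (repF (ix d)) d
    reach d p = subst (λ L → SameFace G (fromD (rep L)) d) (sym (lab-ix d p)) (reach-face d p)
    unique : ∀ d → IsDart G d → ∀ j → SameFace G (repF j) d → j ≡ ix d
    unique d p j q = begin
      j                                ≡⟨ I.strictlyInverseʳ j ⟨
      I.from (I.to j)                  ≡⟨ cong I.from (toSlot-fromSlot (I.to j)) ⟨
      I.from (toSlot (lab j))          ≡⟨ cong (I.from ∘ toSlot) (label-rep (I.to j)) ⟨
      I.from (toSlot (uncurry label (rep (lab j)))) ≡⟨ cong (I.from ∘ toSlot) (face-rep (lab j)) ⟨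
      I.from (toSlot (face (repF j)))  ≡⟨ cong (I.from ∘ toSlot) (SameFace⇒face (IsDart-rep (lab j)) q) ⟩
      ix d                             ∎
      where open ≡-Reasoning

  -- Counting edges

  weight : Fin (A + B) → Fin (A + B) → ℕ
  weight v w = if E° v w ∧ (toℕ v <ᵇ toℕ w) then 1 else 0

  weightᵃ : Fin A → Fin A → ℕ
  weightᵃ i i′ = if adj (inj₁ (Inverse.to a↔ i)) (inj₁ (Inverse.to a↔ i′)) ∧ (toℕ i <ᵇ toℕ i′) then 1 else 0

  weight-aa : ∀ i i′ → weight (left i) (left i′) ≡ weightᵃ i i′
  weight-aa i i′ rewrite to-left i | to-left i′ | Fin.toℕ-↑ˡ i B | Fin.toℕ-↑ˡ i′ B = refl

  left<right : ∀ i j → toℕ (left i) < toℕ (right j)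
  left<right i j rewrite Fin.toℕ-↑ˡ i B | Fin.toℕ-↑ʳ A j = ≤-trans (Fin.toℕ<n i) (m≤m+n A (toℕ j))

  weight-ab : ∀ i j → weight (left i) (right j) ≡ 1
  weight-ab i j
    rewrite to-left i | to-right j | adj-inj (Inverse.to a↔ i) (Inverse.to b↔ j)
          | Equivalence.to Bool.T-≡ (<⇒<ᵇ (left<right i j)) = refl

  weight-ba : ∀ j i → weight (right j) (left i) ≡ 0
  weight-ba j i
    rewrite ≤⇒≮ᵇ (<⇒≤ (left<right i j)) | Bool.∧-zeroʳ (E° (right j) (left i)) = refl

  weight-bb : ∀ j j′ → weight (right j) (right j′) ≡ 0
  weight-bb j j′ rewrite to-right j | to-right j′ = refl

  adj-plain : ∀ p j x → adj (inj₁ p) (inj₁ (inj₂ j , x)) ≡ false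
  adj-plain (inj₁ k , _) j x = refl
  adj-plain (inj₂ k , _) j x = refl

  -- Marked rows are numbered first, so indices from 6 on belong to unmarked rows, which have no
  -- edges within their class.
  weightᵃ-plain : ∀ i j → weightᵃ i (6 ↑ʳ j) ≡ 0
  weightᵃ-plain i j
    rewrite adj-plain (Inverse.to a↔ i) (proj₁ (remQuot {m} 2 j)) (proj₂ (Inverse.to a↔ (6 ↑ʳ j))) = refl

  edgesᵃ : S A (λ i → S A (weightᵃ i)) ≡ 15
  edgesᵃ = begin
    S A (λ i → S A (weightᵃ i))
      ≡⟨ S-cong (λ i → trans (S-+ 6 (m * 2) (weightᵃ i))
                        (cong (marked i +_) (S-zero (m * 2) (weightᵃ-plain i)))) ⟩
    S A (λ i → marked i + 0)
      ≡⟨ S-+ 6 (m * 2) (λ i → marked i + 0) ⟩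
    -- The sum over the six marked vertices evaluates to 15, the number of edges of K₆.
    15 + S (m * 2) (λ j → marked (6 ↑ʳ j) + 0)
      ≡⟨ cong (15 +_) (S-zero (m * 2) λ _ → refl) ⟩
    15 ∎
    where
    open ≡-Reasoning
    marked : Fin A → ℕ
    marked i = S 6 (λ i′ → weightᵃ i (i′ ↑ˡ m * 2))

  edges : edgeCount G ≡ 15 + A * B
  edges = begin
    edgeCount G
      ≡⟨ S-allFin (A + B) (λ v → sum (map (weight v) (allFin (A + B)))) ⟩
    S (A + B) (λ v → sum (map (weight v) (allFin (A + B))))
      ≡⟨ S-cong (λ v → trans (S-allFin (A + B) (weight v)) (S-+ A B (weight v))) ⟩
    S (A + B) (λ v → S A (weight v ∘ left) + S B (weight v ∘ right))
      ≡⟨ S-+ A B (λ v → S A (weight v ∘ left) + S B (weight v ∘ right)) ⟩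
    S A (λ i → S A (weight (left i) ∘ left) + S B (weight (left i) ∘ right))
      + S B (λ j → S A (weight (right j) ∘ left) + S B (weight (right j) ∘ right))
      ≡⟨ cong₂ _+_
           (S-cong λ i → cong₂ _+_ (S-cong (weight-aa i)) (S-const B (weight-ab i)))
           (S-zero B λ j → cong₂ _+_ (S-zero A (weight-ba j)) (S-zero B (weight-bb j))) ⟩
    S A (λ i → S A (weightᵃ i) + B * 1) + 0
      ≡⟨ +-identityʳ _ ⟩
    S A (λ i → S A (weightᵃ i) + B * 1)
      ≡⟨ S-+const A (λ i → S A (weightᵃ i)) ⟩
    S A (λ i → S A (weightᵃ i)) + A * (B * 1)
      ≡⟨ cong₂ _+_ edgesᵃ (cong (A *_) (*-identityʳ B)) ⟩
    15 + A * B ∎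
    where open ≡-Reasoning

  -- Ringel's embedding has genus (P - 1)(Q - 1). Gluing adds 15 edges and trades six quadrangles
  -- for eight triangles and `F`, so the Euler characteristic drops by 12.
  genus : HasGenus G ((2 + m) * (1 + l) + 6)
  genus = P * Q + P * Q + 3 , faceCount , trans (euler m l) (cong (2 +_) (sym edges))
    where
    euler : ∀ m l → ((3 + m) * 2 + (2 + l) * 2) + ((3 + m) * (2 + l) + (3 + m) * (2 + l) + 3)
                      + 2 * ((2 + m) * (1 + l) + 6)
                    ≡ 2 + (15 + (3 + m) * 2 * ((2 + l) * 2))
    euler = solve-∀

  -- The dual graph

  dualSimple : DualSimple G
  dualSimple =
    (λ d p same → label-rev (dart {d} p) (SameFace⇒face p same)) ,
    λ d d′ p p′ same same′ → inj₁ (begin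
      d                                        ≡⟨ fromD-toD d ⟨
      fromD (toD d)                            ≡⟨ cong fromD (edge-label (dart {d} p)) ⟨
      fromD (edge (face d) (face (rev G d)))   ≡⟨ cong fromD (cong₂ edge (SameFace⇒face p same)
                                                    (SameFace⇒face (IsDart-rev {d} p) same′)) ⟩
      fromD (edge (face d′) (face (rev G d′))) ≡⟨ cong fromD (edge-label (dart {d′} p′)) ⟩
      fromD (toD d′)                           ≡⟨ fromD-toD d′ ⟩
      d′                                       ∎)
    where open ≡-Reasoning

  dualCut : DualHas1Cut G
  dualCut = d₀ , IsDart-rep F , dʸ , dᵘ , IsDart-rep Y₀ , IsDart-rep (U false) ,
      (λ same → F≢Y (SameFace⇒face (IsDart-rep F) same)) ,
      (λ same → F≢U (SameFace⇒face (IsDart-rep F) same)) ,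
      λ walk → U-not-quadrangle (proj₂ (stays walk))
    where
    Y₀ : Label
    Y₀ = Y (inj₁ 0F) (inj₁ false)
    d₀ dʸ dᵘ : Dart G
    d₀ = fromD (rep F)
    dʸ = fromD (rep Y₀)
    dᵘ = fromD (rep (U false))
    F≢Y : face d₀ ≢ face dʸ
    F≢Y eq with () ← trans (sym (face-rep F)) (trans eq (face-rep Y₀))
    F≢U : face d₀ ≢ face dᵘ
    F≢U eq with () ← trans (sym (face-rep F)) (trans eq (face-rep (U false)))
    U-not-quadrangle : ¬ Quadrangle (face dᵘ)
    U-not-quadrangle q with () ← subst Quadrangle (face-rep (U false)) q
    stays : ∀ {y} → DualWalk G d₀ dʸ y → IsDart G y × Quadrangle (face y)
    stays here = IsDart-rep Y₀ , subst Quadrangle (sym (face-rep Y₀)) isY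
    stays (along walk same p _) with stays walk
    ... | q , quadrangle = p , subst Quadrangle (SameFace⇒face q same) quadrangle
    stays (cross {y = y} walk ¬F) with stays walk
    ... | q , quadrangle with cross-quadrangle (dart {y} q) quadrangle
    ...   | inj₁ quadrangle′ = IsDart-rev {y} q , quadrangle′
    -- Crossing into `F` is the only exit, and the walk is forbidden to take it.
    ...   | inj₂ isF = ⊥-elim (¬F (subst (λ L → SameFace G (fromD (rep L)) (rev G y)) isF
                         (reach-face (rev G y) (IsDart-rev {y} q))))

-- Choice of parameters and the bound

realize : ∀ p q {c} → c ≤ (6 + p) * 2 → c ≤ (4 + q) * 2 → Realizes-δ₁ c ((5 + p) * (3 + q) + 6)
realize p q c≤A c≤B = G , c-connected c≤A c≤B , genus , dualSimple , dualCut
  where open GluedGraph (rowCycle p) (colCycle q)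

halve : ∀ d → ∃[ t ] (d ≡ t * 2 ⊎ d ≡ 1 + t * 2)
halve zero = 0 , inj₁ refl
halve (suc d) with halve d
... | t , inj₁ refl = t , inj₂ refl
... | t , inj₂ refl = suc t , inj₁ refl

-- An explicit slack `k` turns the inequality into a polynomial identity, free of truncated
-- subtraction, for the ring solver.
genus-bound : ∀ c s k → 4 * s + 5 + k ≡ c * c + 6 * c → 4 * s ≤ c * c + 6 * c ∸ 5
genus-bound c s k eq = m+n≤o⇒m≤o∸n (4 * s) (subst (4 * s + 5 ≤_) eq (m≤m+n (4 * s + 5) k))

odd-slack : ∀ t → 4 * ((5 + t) * (5 + t) + 6) + 5 + (58 + t * 16) ≡
                  (11 + t * 2) * (11 + t * 2) + 6 * (11 + t * 2)
odd-slack = solve-∀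

even-slack : ∀ t → 4 * ((5 + t) * (5 + t) + 6) + 5 + (87 + t * 20) ≡
                   (12 + t * 2) * (12 + t * 2) + 6 * (12 + t * 2)
even-slack = solve-∀

-- The marked quadrangles need P ≥ 6 and Q ≥ 4; otherwise the smallest P and Q
-- with c ≤ 2P and c ≤ 2Q are used.
theorem1 : (c : ℕ) → 7 ≤ c →
    Σ ℕ λ s → Realizes-δ₁ c s × (4 * s ≤ c * c + 6 * c ∸ 5)
theorem1 c 7≤c with c ∸ 7 | m+[n∸m]≡n 7≤c
... | 0 | refl = 21 , realize 0 0 (≤ᵇ⇒≤ 7 12 _) (≤ᵇ⇒≤ 7 8 _) , ≤ᵇ⇒≤ 84 86 _
... | 1 | refl = 21 , realize 0 0 (≤ᵇ⇒≤ 8 12 _) (≤ᵇ⇒≤ 8 8 _) , ≤ᵇ⇒≤ 84 107 _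
... | 2 | refl = 26 , realize 0 1 (≤ᵇ⇒≤ 9 12 _) (≤ᵇ⇒≤ 9 10 _) , ≤ᵇ⇒≤ 104 130 _
... | 3 | refl = 26 , realize 0 1 (≤ᵇ⇒≤ 10 12 _) (≤ᵇ⇒≤ 10 10 _) , ≤ᵇ⇒≤ 104 155 _
... | suc (suc (suc (suc d))) | refl with halve d
-- From `c = 11` on, P = Q = 6 + t, with c = 11 + 2t here and c = 12 + 2t below.
...   | t , inj₁ refl = (5 + t) * (5 + t) + 6 , realize t (2 + t) (n≤1+n _) (n≤1+n _) ,
        genus-bound (11 + t * 2) ((5 + t) * (5 + t) + 6) (58 + t * 16) (odd-slack t)
...   | t , inj₂ refl = (5 + t) * (5 + t) + 6 , realize t (2 + t) ≤-refl ≤-refl ,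
        genus-bound (12 + t * 2) ((5 + t) * (5 + t) + 6) (87 + t * 20) (even-slack t)
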